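{- For every $n \geq 3$, the $n$-sun $S_n$ is in $B_2^m$.
   Context: For $n\ge 3$, the $n$-sun $S_n$ is the graph with vertex set $\{x_1,\dots,x_n,y_1,\dots,y_n\}$ and edge set consisting of all edges $\{x_i,x_j\}$ for $1\le i<j\le n$, the edges $\{x_i,y_i\},\{x_{i+1},y_i\}$ for $1\le i<n$, and the edges $\{x_1,y_n\},\{x_n,y_n\}$. An EPG representation of a graph is a set of paths on a rectangular grid (sequences of grid points joined consecutively by grid edges), one per vertex, such that two vertices are adjacent iff their paths share a grid edge. A bend is a point of a path where a horizontal and a vertical grid edge of the path meet. A path is monotonic if it is ascending in both columns and rows. $B_k^m$ is the class of graphs having an EPG representation in which every path is monotonic and has at most $k$ bends. -}

module Defs where

open import Data.Fin.Base as Fin using (Fin; toℕ)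
open import Data.Fin.Properties as Finₚ using (+↔⊎)
open import Data.List.Base using (List; []; _∷_; length)
open import Data.List.Membership.Propositional using (_∈_)
open import Data.List.NonEmpty.Base using (List⁺; toList)
open import Data.List.Relation.Unary.Linked using (Linked)
open import Data.Nat.Base using (ℕ; suc; _+_; _≤_; _<_; ∣_-_∣)
open import Data.Product.Base using (Σ-syntax; ∃-syntax; _×_; proj₁; proj₂)
open import Data.Sum.Base using (_⊎_; inj₁; inj₂)
open import Function.Bundles using (_↔_; _⇔_)
open import Relation.Binary.Construct.Closure.Symmetric as Sym using (SymClosure; fwd; bwd)
open import Relation.Binary.Definitions using (Symmetric)
open import Relation.Binary.PropositionalEquality.Core using (_≡_; _≢_; refl)
open import Relation.Nullary.Negation.Core using (¬_)

record Graph : Set₁ where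
  field
    Vertex      : Set
    Adj         : Vertex → Vertex → Set
    symmetric   : Symmetric Adj
    irreflexive : ∀ {v} → ¬ Adj v v
    order       : ℕ
    finite      : Fin order ↔ Vertex

-- The usual indices 1, …, n are shifted to 0, …, n - 1.

SunVertex : ℕ → Set
SunVertex n = Fin n ⊎ Fin n

pattern x i = inj₁ i
pattern y i = inj₂ i

data SunEdge (n : ℕ) : SunVertex n → SunVertex n → Set where
  clique     : ∀ {i j} → i Fin.< j → SunEdge n (x i) (x j)
  same       : ∀ {i} → suc (toℕ i) < n → SunEdge n (x i) (y i)
  next       : ∀ {i j} → toℕ j ≡ suc (toℕ i) → SunEdge n (x j) (y i)
  first-last : ∀ {i j} → toℕ i ≡ 0 → suc (toℕ j) ≡ n → SunEdge n (x i) (y j)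
  last-last  : ∀ {i} → suc (toℕ i) ≡ n → SunEdge n (x i) (y i)

Sun : ℕ → Graph
Sun n = record
  { Vertex      = SunVertex n
  ; Adj         = SymClosure (SunEdge n)
  ; symmetric   = Sym.symmetric (SunEdge n)
  ; irreflexive = λ { (fwd e) → no-loop e refl ; (bwd e) → no-loop e refl }
  ; order       = n + n
  ; finite      = +↔⊎
  }
  where
  no-loop : ∀ {u v} → SunEdge n u v → u ≢ v
  no-loop (clique i<j) refl = Finₚ.<-irrefl refl i<j

data Consecutive {A : Set} (u v : A) : List A → Set where
  here  : ∀ {ws} → Consecutive u v (u ∷ v ∷ ws)
  there : ∀ {w ws} → Consecutive u v ws → Consecutive u v (w ∷ ws)

module Grid (cols rows : ℕ) where

  Point : Set
  Point = Fin cols × Fin rows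

  col row : Point → ℕ
  col p = toℕ (proj₁ p)
  row p = toℕ (proj₂ p)

  Horizontal Vertical GridEdge : Point → Point → Set
  Horizontal p q = ∣ col p - col q ∣ ≡ 1 × row p ≡ row q
  Vertical   p q = col p ≡ col q × ∣ row p - row q ∣ ≡ 1
  GridEdge   p q = Horizontal p q ⊎ Vertical p q

  record Path : Set where
    field
      points : List⁺ Point
      linked : Linked GridEdge (toList points)

  open Path public

  -- Edges are undirected: {p , q} is an edge of P if P traverses it in
  -- either direction.
  HasEdge : Path → Point → Point → Set
  HasEdge P = SymClosure (λ p q → Consecutive p q (toList (points P)))

  ShareEdge : Path → Path → Set
  ShareEdge P Q = ∃[ p ] ∃[ q ] (HasEdge P p q × HasEdge Q p q)

  Bend : Path → Point → Set
  Bend P p = (∃[ q ] (HasEdge P p q × Horizontal p q))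
           × (∃[ r ] (HasEdge P p r × Vertical p r))

  AtMostBends : ℕ → Path → Set
  AtMostBends k P = ∃[ ps ] (length ps ≤ k × (∀ p → Bend P p → p ∈ ps))

  Monotonic : Path → Set
  Monotonic P = Linked (λ p q → col p ≤ col q × row p ≤ row q) (toList (points P))

  record EPGRepresentation (G : Graph) : Set where
    open Graph G
    field
      path     : Vertex → Path
      adjacent : ∀ u v → u ≢ v → Adj u v ⇔ ShareEdge (path u) (path v)

-- B^m k G : the graph G belongs to the class B_k^m.
B^m : ℕ → Graph → Set
B^m k G = ∃[ cols ] ∃[ rows ] (let open Grid cols rows in
  Σ[ R ∈ EPGRepresentation G ]
    (∀ v → let P = EPGRepresentation.path R v in Monotonic P × AtMostBends k P))

{-# OPTIONS --safe #-}

-- Every vertex is represented by a Z-shaped path: it runs along a lower row,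
-- turns up into a column, crosses from the lower to the upper half of the
-- grid, and runs along an upper row to the right border.  Two such paths share
-- an edge exactly when they agree in the lower row, the column or the upper
-- row.  The paths of the x i have a common column and use rows i and n + i;
-- the path of y i has a private column, enters on row i, which it shares only
-- with x i, and leaves on row n + (i + 1 mod n), which it shares only with
-- x (i + 1 mod n).

module Submission where

open import Defs
open import Data.Fin.Base as Fin using (Fin; zero; suc; toℕ; fromℕ; inject₁; _↑ˡ_; _↑ʳ_)
open import Data.Fin.Properties as Finₚ
  using (toℕ-fromℕ; toℕ-inject₁; toℕ-↑ˡ; toℕ-↑ʳ; splitAt-↑ˡ; splitAt-↑ʳ; ↑ˡ-injective; ↑ʳ-injective)
open import Data.Fin.Relation.Unary.Top using (view; ‵fromℕ; ‵inject₁)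
open import Data.List.Base using (List; []; _∷_)
open import Data.List.Membership.Propositional using (_∈_)
open import Data.List.NonEmpty.Base using (_∷_)
open import Data.List.Relation.Unary.Any using (here; there)
open import Data.List.Relation.Unary.Linked as Linked using (Linked; [-]; _∷_)
open import Data.Nat.Base using (ℕ; suc; _+_; _≤_; _<_; ∣_-_∣; z≤n; s≤s)
open import Data.Nat.Properties as ℕₚ using (≤-refl; ≤-reflexive)
open import Data.Product.Base using (_×_; _,_; proj₁; proj₂)
open import Data.Sum.Base using (_⊎_; inj₁; inj₂)
open import Function.Base using (_∘_)
open import Function.Bundles using (mk⇔)
open import Level using (0ℓ)
open import Relation.Binary.Construct.Closure.ReflexiveTransitive using (Star; ε; _◅_; _◅◅_; gmap)
open import Relation.Binary.Construct.Closure.Symmetric as Sym using (SymClosure; fwd; bwd)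
open import Relation.Binary.Core using (Rel; _⇒_)
open import Relation.Binary.Definitions using (Symmetric; tri<; tri≈; tri>)
open import Relation.Binary.PropositionalEquality using (_≡_; _≢_; refl; sym; trans; cong; subst)
open import Relation.Nullary.Negation using (contradiction)

-- Walks of a relation and their lists of points.

module _ {A : Set} {R : Rel A 0ℓ} where

  tail : ∀ {p q} → Star R p q → List A
  tail ε                 = []
  tail (_◅_ {j = p} _ w) = p ∷ tail w

  tail-linked : ∀ {p q} (w : Star R p q) → Linked R (p ∷ tail w)
  tail-linked ε       = [-]
  tail-linked (e ◅ w) = e ∷ tail-linked w

  consecutive⇒related : ∀ {p q us} → Linked R us → Consecutive p q us → R p q
  consecutive⇒related (e ∷ _) here      = e
  consecutive⇒related (_ ∷ l) (there c) = consecutive⇒related l c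
  consecutive⇒related [-]     (there ())

  -- Locates a chosen edge inside a composite walk without unfolding the pieces before it, whose
  -- lengths vary.
  consecutive-◅◅ʳ : ∀ {a b o p q} (v : Star R o p) {w : Star R p q} →
                    Consecutive a b (p ∷ tail w) → Consecutive a b (o ∷ tail (v ◅◅ w))
  consecutive-◅◅ʳ ε       c = c
  consecutive-◅◅ʳ (_ ◅ v) c = there (consecutive-◅◅ʳ v c)

infix 4 _⋖_

_⋖_ : ∀ {m} → Fin m → Fin m → Set
a ⋖ b = toℕ b ≡ suc (toℕ a)

⋖⇒≢ : ∀ {m} {a b : Fin m} → a ⋖ b → toℕ a ≢ toℕ b
⋖⇒≢ a⋖b eq = ℕₚ.1+n≢n (sym (trans eq a⋖b))

⋖⇒≤ : ∀ {m} {a b : Fin m} → a ⋖ b → toℕ a ≤ toℕ b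
⋖⇒≤ a⋖b = ℕₚ.<⇒≤ (≤-reflexive (sym a⋖b))

⋖⇒distance-1 : ∀ {m} {a b : Fin m} → a ⋖ b → ∣ toℕ a - toℕ b ∣ ≡ 1
⋖⇒distance-1 {a = a} a⋖b rewrite a⋖b =
  trans (cong (∣ toℕ a -_∣) (ℕₚ.+-comm 1 (toℕ a))) (ℕₚ.∣m-m+n∣≡n (toℕ a) 1)

climb : ∀ {m} (a b : Fin m) → a Fin.≤ b → Star _⋖_ a b
climb zero    zero    _ = ε
-- Matching the implicit argument provides a `zero` in the smaller `Fin`; the walk from it to `b`,
-- shifted by `suc`, continues from `suc zero`.
climb {suc (suc _)} zero (suc b) _ = refl ◅ gmap suc (cong suc) (climb zero b z≤n)
climb (suc a) (suc b) (s≤s a≤b) = gmap suc (cong suc) (climb a b a≤b)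

↑ˡ≢↑ʳ : ∀ {m n} {i : Fin m} {j : Fin n} → i ↑ˡ n ≢ m ↑ʳ j
↑ˡ≢↑ʳ {m} {n} {i} {j} eq
  with () ← trans (sym (splitAt-↑ˡ m i n)) (trans (cong (Fin.splitAt m) eq) (splitAt-↑ʳ m n j))

-- Z-shaped paths.

module ZShape (m : ℕ) where

  private
    n = suc m

  -- One column for each of the `suc n` values of `middle`, plus a border on either side; `n` lower
  -- and `n` upper rows.
  open Grid (3 + n) (n + n)

  record Shape : Set where
    constructor shape
    field
      lower  : Fin n
      middle : Fin (suc n)
      upper  : Fin n

    entry exit : Fin (n + n)
    entry = lower ↑ˡ n
    exit  = n ↑ʳ upper

    -- Neither border column is used, so both horizontal parts are nonempty.
    column : Fin (3 + n)
    column = suc (inject₁ middle)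

  open Shape

  -- Records only where steps may lie and that they ascend, not their order. Monotonicity, the bend
  -- bound and the analysis of shared edges follow from this alone, without inspecting the points of
  -- the path.
  data Step (z : Shape) : Rel Point 0ℓ where
    right : ∀ {j a b} → j ≡ entry z ⊎ j ≡ exit z → a ⋖ b → Step z (a , j) (b , j)
    up    : ∀ {i j} → i ⋖ j → Step z (column z , i) (column z , j)

  step⇒edge : ∀ {z} → Step z ⇒ GridEdge
  step⇒edge (right _ a⋖b) = inj₁ (⋖⇒distance-1 a⋖b , refl)
  step⇒edge (up i⋖j)      = inj₂ (refl , ⋖⇒distance-1 i⋖j)

  GridEdge-sym : Symmetric GridEdge
  GridEdge-sym {p} {q} (inj₁ (d , eq)) = inj₁ (trans (ℕₚ.∣-∣-comm (col q) (col p)) d , sym eq)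
  GridEdge-sym {p} {q} (inj₂ (eq , d)) = inj₂ (sym eq , trans (ℕₚ.∣-∣-comm (row q) (row p)) d)

  module _ (z : Shape) where

    private
      last : Fin (2 + n)
      last = fromℕ (suc n)

      low high : Fin (n + n)
      -- The topmost lower row and the bottommost upper row: whatever its entry and exit, every path
      -- crosses between them.
      low  = fromℕ m ↑ˡ n
      high = n ↑ʳ zero

      last⋖ : inject₁ last ⋖ suc last
      last⋖ = cong suc (sym (toℕ-inject₁ last))

      low⋖high : low ⋖ high
      low⋖high = trans (toℕ-↑ʳ n (zero {m})) (trans (ℕₚ.+-identityʳ n)
        (cong suc (sym (trans (toℕ-↑ˡ (fromℕ m) n) (toℕ-fromℕ m)))))

      along : ∀ {j} a b → j ≡ entry z ⊎ j ≡ exit z → a Fin.≤ b → Star (Step z) (a , j) (b , j)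
      along {j} a b p a≤b = gmap (_, j) (right p) (climb a b a≤b)

      upwards : ∀ i j → i Fin.≤ j → Star (Step z) (column z , i) (column z , j)
      upwards i j i≤j = gmap (column z ,_) up (climb i j i≤j)

      enter : Step z (zero , entry z) (suc zero , entry z)
      enter = right (inj₁ refl) refl

      cross : Step z (column z , low) (column z , high)
      cross = up low⋖high

      leave : Step z (inject₁ last , exit z) (suc last , exit z)
      leave = right (inj₂ refl) last⋖

      to-low : Star (Step z) (zero , entry z) (column z , low)
      to-low = enter ◅ along _ _ (inj₁ refl) (s≤s z≤n) ◅◅ upwards _ _ entry≤low
        where
        entry≤low : entry z Fin.≤ low
        entry≤low rewrite toℕ-↑ˡ (lower z) n | toℕ-↑ˡ (fromℕ m) n = Finₚ.≤fromℕ (lower z)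

      from-high : Star (Step z) (column z , high) (inject₁ last , exit z)
      from-high = upwards _ _ high≤exit ◅◅ along _ _ (inj₂ refl) column≤last
        where
        high≤exit : high Fin.≤ exit z
        high≤exit rewrite toℕ-↑ʳ n (zero {m}) | toℕ-↑ʳ n (upper z) = ℕₚ.+-monoʳ-≤ n z≤n

        column≤last : column z Fin.≤ inject₁ last
        column≤last rewrite toℕ-inject₁ (middle z) | toℕ-inject₁ (fromℕ n) = s≤s (Finₚ.≤fromℕ (middle z))

      -- The endpoints of `enter`, `cross` and `leave` depend only on `lower`, `middle` and `upper`
      -- respectively, so each step witnesses sharing when that field agrees.
      walk : Star (Step z) (zero , entry z) (suc last , exit z)
      walk = to-low ◅◅ cross ◅ from-high ◅◅ leave ◅ ε

    zpath : Path
    zpath = record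
      { points = (zero , entry z) ∷ tail walk
      ; linked = Linked.map step⇒edge (tail-linked walk)
      }

    zpath-monotonic : Monotonic zpath
    zpath-monotonic = Linked.map step⇒≤ (tail-linked walk)
      where
      step⇒≤ : ∀ {p q} → Step z p q → col p ≤ col q × row p ≤ row q
      step⇒≤ (right _ a⋖b) = ⋖⇒≤ a⋖b , ≤-refl
      step⇒≤ (up i⋖j)      = ≤-refl , ⋖⇒≤ i⋖j

    hasEdge⇒step : ∀ {p q} → HasEdge zpath p q → SymClosure (Step z) p q
    hasEdge⇒step = Sym.map (consecutive⇒related (tail-linked walk))

    enter-edge : HasEdge zpath (zero , entry z) (suc zero , entry z)
    enter-edge = fwd here

    cross-edge : HasEdge zpath (column z , low) (column z , high)
    cross-edge = fwd (consecutive-◅◅ʳ to-low here)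

    leave-edge : HasEdge zpath (inject₁ last , exit z) (suc last , exit z)
    leave-edge = fwd (consecutive-◅◅ʳ to-low (there (consecutive-◅◅ʳ from-high here)))

    horizontal⇒row : ∀ {p q} → SymClosure (Step z) p q → Horizontal p q →
                     proj₂ p ≡ entry z ⊎ proj₂ p ≡ exit z
    horizontal⇒row (fwd (right j∈z _)) _        = j∈z
    horizontal⇒row (bwd (right j∈z _)) _        = j∈z
    horizontal⇒row (fwd (up i⋖j))      (_ , eq) = contradiction eq (⋖⇒≢ i⋖j)
    horizontal⇒row (bwd (up i⋖j))      (_ , eq) = contradiction (sym eq) (⋖⇒≢ i⋖j)

    vertical⇒column : ∀ {p q} → SymClosure (Step z) p q → Vertical p q → proj₁ p ≡ column z
    vertical⇒column (fwd (up _))        _        = refl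
    vertical⇒column (bwd (up _))        _        = refl
    vertical⇒column (fwd (right _ a⋖b)) (eq , _) = contradiction eq (⋖⇒≢ a⋖b)
    vertical⇒column (bwd (right _ a⋖b)) (eq , _) = contradiction (sym eq) (⋖⇒≢ a⋖b)

    -- The vertical edge at a bend forces its column, and the horizontal edge leaves two choices for
    -- its row.
    zpath-bends : AtMostBends 2 zpath
    zpath-bends = (column z , entry z) ∷ (column z , exit z) ∷ [] , ≤-refl , bend∈
      where
      bend∈ : ∀ p → Bend zpath p → p ∈ (column z , entry z) ∷ (column z , exit z) ∷ []
      bend∈ p ((_ , pq , h) , (_ , pr , v))
        with vertical⇒column (hasEdge⇒step pr) v | horizontal⇒row (hasEdge⇒step pq) h
      ... | refl | inj₁ refl = here refl
      ... | refl | inj₂ refl = there (here refl)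

  -- Shared edges of two Z-shaped paths.

  Agree : Rel Shape 0ℓ
  Agree z z′ = lower z ≡ lower z′ ⊎ middle z ≡ middle z′ ⊎ upper z ≡ upper z′

  agree⇒share : ∀ {z z′} → Agree z z′ → ShareEdge (zpath z) (zpath z′)
  agree⇒share {z} {z′} (inj₁ refl)        = _ , _ , enter-edge z , enter-edge z′
  agree⇒share {z} {z′} (inj₂ (inj₁ refl)) = _ , _ , cross-edge z , cross-edge z′
  agree⇒share {z} {z′} (inj₂ (inj₂ refl)) = _ , _ , leave-edge z , leave-edge z′

  module _ {z z′ : Shape} where

    common-row : ∀ {j} → j ≡ entry z ⊎ j ≡ exit z → j ≡ entry z′ ⊎ j ≡ exit z′ → Agree z z′
    common-row (inj₁ refl) (inj₁ eq) = inj₁ (↑ˡ-injective n _ _ eq)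
    -- Entry rows lie in the lower half of the grid and exit rows in the upper half, so the mixed
    -- cases are impossible.
    common-row (inj₁ refl) (inj₂ eq) = contradiction eq ↑ˡ≢↑ʳ
    common-row (inj₂ refl) (inj₁ eq) = contradiction (sym eq) ↑ˡ≢↑ʳ
    common-row (inj₂ refl) (inj₂ eq) = inj₂ (inj₂ (↑ʳ-injective n _ _ eq))

    common-column : column z ≡ column z′ → Agree z z′
    common-column = inj₂ ∘ inj₁ ∘ Finₚ.inject₁-injective ∘ Finₚ.suc-injective

    -- The orientation of an edge does not depend on the path using it, so both paths must use it in
    -- the same row part or both in their columns.
    common-edge : ∀ {p q} → GridEdge p q →
                  SymClosure (Step z) p q → SymClosure (Step z′) p q → Agree z z′
    common-edge (inj₁ h) e e′ = common-row (horizontal⇒row z e h) (horizontal⇒row z′ e′ h)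
    common-edge (inj₂ v) e e′ =
      common-column (trans (sym (vertical⇒column z e v)) (vertical⇒column z′ e′ v))

    share⇒agree : ShareEdge (zpath z) (zpath z′) → Agree z z′
    share⇒agree (_ , _ , e , e′) =
      common-edge (Sym.fold GridEdge-sym step⇒edge (hasEdge⇒step z e)) (hasEdge⇒step z e) (hasEdge⇒step z′ e′)

-- The sun and its assignment of shapes.

rotate : ∀ {m} → Fin (suc m) → Fin (suc m)
rotate i with view i
... | ‵fromℕ     = zero
... | ‵inject₁ j = suc j

rotate-injective : ∀ {m} {i j : Fin (suc m)} → rotate i ≡ rotate j → i ≡ j
rotate-injective {i = i} {j} eq with view i | view j
... | ‵fromℕ     | ‵fromℕ     = refl
... | ‵inject₁ _ | ‵inject₁ _ = cong inject₁ (Finₚ.suc-injective eq)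
... | ‵fromℕ     | ‵inject₁ _ = contradiction eq λ ()
... | ‵inject₁ _ | ‵fromℕ     = contradiction eq λ ()

module _ {m : ℕ} where

  -- `same` and `last-last` together form the diagonal, `next` and `first-last` the graph of
  -- `rotate`.
  edge⇒incident : ∀ {i j : Fin (suc m)} → SunEdge (suc m) (x i) (y j) → i ≡ j ⊎ i ≡ rotate j
  edge⇒incident (same _)      = inj₁ refl
  edge⇒incident (last-last _) = inj₁ refl
  edge⇒incident {i} {j} (next eq) with view j
  -- The successor of the last index would be `suc m`, which is out of range.
  ... | ‵fromℕ     = contradiction
    (trans eq (cong suc (toℕ-fromℕ m))) (ℕₚ.<⇒≢ (Finₚ.toℕ<n i))
  ... | ‵inject₁ k = inj₂ (Finₚ.toℕ-injective (trans eq (cong suc (toℕ-inject₁ k))))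
  edge⇒incident {i} {j} (first-last eq eq′) with view j
  ... | ‵fromℕ     = inj₂ (Finₚ.toℕ-injective eq)
  ... | ‵inject₁ k = contradiction
    (trans (sym (toℕ-inject₁ k)) (ℕₚ.suc-injective eq′)) (ℕₚ.<⇒≢ (Finₚ.toℕ<n k))

  diagonal-edge : ∀ i → SunEdge (suc m) (x i) (y i)
  diagonal-edge i with view i
  ... | ‵fromℕ     = last-last (cong suc (toℕ-fromℕ m))
  ... | ‵inject₁ k = same (s≤s (subst (_< m) (sym (toℕ-inject₁ k)) (Finₚ.toℕ<n k)))

  rotate-edge : ∀ j → SunEdge (suc m) (x (rotate j)) (y j)
  rotate-edge j with view j
  ... | ‵fromℕ     = first-last refl (cong suc (toℕ-fromℕ m))
  ... | ‵inject₁ k = next (cong suc (sym (toℕ-inject₁ k)))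

  open ZShape m
  open Grid (3 + suc m) (suc m + suc m)
  open Graph (Sun (suc m)) using (Adj)

  sunShape : SunVertex (suc m) → Shape
  sunShape (x i) = shape i zero i
  sunShape (y i) = shape i (suc i) (rotate i)

  Agree-sym : ∀ {z z′} → Agree z z′ → Agree z′ z
  Agree-sym (inj₁ eq)        = inj₁ (sym eq)
  Agree-sym (inj₂ (inj₁ eq)) = inj₂ (inj₁ (sym eq))
  Agree-sym (inj₂ (inj₂ eq)) = inj₂ (inj₂ (sym eq))

  edge⇒agree : ∀ {u v} → SunEdge (suc m) u v → Agree (sunShape u) (sunShape v)
  edge⇒agree {x i} {x j} _ = inj₂ (inj₁ refl)
  edge⇒agree {x i} {y j} e with edge⇒incident e
  ... | inj₁ eq = inj₁ eq
  ... | inj₂ eq = inj₂ (inj₂ eq)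

  adj⇒agree : ∀ {u v} → Adj u v → Agree (sunShape u) (sunShape v)
  adj⇒agree (fwd e) = edge⇒agree e
  adj⇒agree (bwd e) = Agree-sym (edge⇒agree e)

  agree⇒edge : ∀ {i j} → Agree (sunShape (x i)) (sunShape (y j)) → SunEdge (suc m) (x i) (y j)
  -- Agreement in `middle` is ruled out by `zero` against `suc j`.
  agree⇒edge (inj₁ refl)        = diagonal-edge _
  agree⇒edge (inj₂ (inj₂ refl)) = rotate-edge _

  agree⇒adj : ∀ u v → u ≢ v → Agree (sunShape u) (sunShape v) → Adj u v
  agree⇒adj (x i) (x j) u≢v _ with Finₚ.<-cmp i j
  ... | tri< i<j _ _  = fwd (clique i<j)
  ... | tri≈ _ refl _ = contradiction refl u≢v
  ... | tri> _ _ j<i  = bwd (clique j<i)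
  agree⇒adj (x i) (y j) _ a = fwd (agree⇒edge a)
  agree⇒adj (y i) (x j) _ a = bwd (agree⇒edge (Agree-sym a))
  agree⇒adj (y i) (y j) u≢v a = contradiction (cong inj₂ (i≡j a)) u≢v
    where
    -- All three fields of `sunShape (y i)` are injective in `i`.
    i≡j : Agree (sunShape (y i)) (sunShape (y j)) → i ≡ j
    i≡j (inj₁ eq)        = eq
    i≡j (inj₂ (inj₁ eq)) = Finₚ.suc-injective eq
    i≡j (inj₂ (inj₂ eq)) = rotate-injective eq

  sunRepresentation : EPGRepresentation (Sun (suc m))
  sunRepresentation = record
    { path     = zpath ∘ sunShape
    ; adjacent = λ u v u≢v → mk⇔ (agree⇒share ∘ adj⇒agree) (agree⇒adj u v u≢v ∘ share⇒agree)
    }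

theorem3p8 : (n : ℕ) → 3 ≤ n → B^m 2 (Sun n)
theorem3p8 (suc m) _ = _ , _ , sunRepresentation ,
  λ v → zpath-monotonic (sunShape v) , zpath-bends (sunShape v)
  where open ZShape m
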